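{- Let $k$ be a positive integer. For every integer $n\ge 1$, $$M_{n+1}^{(k)}=\det(V_n),$$ where $V_n$ is the $n\times n$ tridiagonal matrix $$V_n=\begin{bmatrix} M_{2}^{(k)} & M_{1}^{(k)} & & & & \\ 2^k & 2^{k}+1 & 1 & & & \\ & 2^k & 2^{k}+1 & 1 & & \\ & & \ddots & \ddots & \ddots & \\ & & & 2^k & 2^{k}+1 & 1 \\ & & & & 2^k & 2^{k}+1 \end{bmatrix}_{n\times n}.$$
   Context: The Mersenne numbers $\{M_n\}_{n\ge 0}$ are defined by $M_0=0$, $M_1=1$, $M_{n+2}=3M_{n+1}-2M_n$, i.e. $M_n=2^n-1$. For a positive integer $k$, the higher order Mersenne numbers are $M_n^{(k)}=M_{kn}/M_k$ for $n=0,1,2,\dots$. The entries of $V_n$ are: $(1,1)$ entry $M_2^{(k)}$; $(1,2)$ entry $M_1^{(k)}$ (when $n\ge2$); $(i,i)$ entry $2^k+1$ for $2\le i\le n$; $(i,i+1)$ entry $1$ for $2\le i\le n-1$; $(i+1,i)$ entry $2^k$ for $1\le i\le n-1$; all other entries $0$. In particular $V_1=[M_2^{(k)}]$. -}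

module Defs where

open import Algebra.Bundles using (CommutativeRing)
open import Data.Fin.Base using (Fin; zero; suc; toℕ; punchIn)
open import Data.Integer.Base as ℤ using (ℤ; +_; 0ℤ; 1ℤ)
open import Data.Integer.Properties as ℤₚ using (pos-*)
open import Data.Integer.Tactic.RingSolver using (solve-∀)
open import Data.Nat.Base as ℕ using (ℕ; zero; suc)
import Data.Nat.Properties as ℕₚ
open import Data.Rational.Base as ℚ using (ℚ; 0ℚ; 1ℚ; _÷_)
open import Data.Rational.Literals using (fromℤ)
import Data.Rational.Properties as ℚₚ
open import Relation.Binary.PropositionalEquality

private variable
  n : ℕ

Matrix : ∀ {a} → Set a → ℕ → Set a
Matrix A n = Fin n → Fin n → A

module Determinant {c ℓ} (R : CommutativeRing c ℓ) where
  open CommutativeRing R hiding (zero)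
  open import Algebra.Properties.Semiring.Sum semiring using (sum)
  open import Algebra.Properties.Semiring.Exp semiring using (_^_)

  -- Deletes the top row and column j.
  minor : Matrix Carrier (suc n) → Fin (suc n) → Matrix Carrier n
  minor A j r s = A (suc r) (punchIn j s)

  -- Laplace expansion along the top row; toℕ j counts columns from 0, so
  -- the sign (-1)^j agrees with the usual (-1)^(1+j) for 1-based columns.
  det : Matrix Carrier n → Carrier
  det {zero}  A = 1#
  det {suc n} A = sum λ j → ((- 1#) ^ toℕ j) * (A zero j * det (minor A j))

open Determinant ℚₚ.+-*-commutativeRing public using (det)

M : ℕ → ℤ
M zero          = 0ℤ
M (suc zero)    = 1ℤ
M (suc (suc n)) = + 3 ℤ.* M (suc n) ℤ.- + 2 ℤ.* M n

M-closed : ∀ n → M n ≡ + (2 ℕ.^ n) ℤ.- 1ℤ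
M-closed zero          = refl
M-closed (suc zero)    = refl
M-closed (suc (suc n)) = begin
  + 3 ℤ.* M (suc n) ℤ.- + 2 ℤ.* M n
    ≡⟨ cong₂ (λ x y → + 3 ℤ.* x ℤ.- + 2 ℤ.* y) (M-closed (suc n)) (M-closed n) ⟩
  + 3 ℤ.* (+ (2 ℕ.* p) ℤ.- 1ℤ) ℤ.- + 2 ℤ.* (+ p ℤ.- 1ℤ)
    ≡⟨ cong (λ x → + 3 ℤ.* (x ℤ.- 1ℤ) ℤ.- + 2 ℤ.* (+ p ℤ.- 1ℤ)) (pos-* 2 p) ⟩
  + 3 ℤ.* (+ 2 ℤ.* + p ℤ.- 1ℤ) ℤ.- + 2 ℤ.* (+ p ℤ.- 1ℤ)
    ≡⟨ rearrange (+ p) ⟩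
  + 2 ℤ.* (+ 2 ℤ.* + p) ℤ.- 1ℤ
    ≡⟨ cong (λ x → + 2 ℤ.* x ℤ.- 1ℤ) (pos-* 2 p) ⟨
  + 2 ℤ.* + (2 ℕ.* p) ℤ.- 1ℤ
    ≡⟨ cong (ℤ._- 1ℤ) (pos-* 2 (2 ℕ.* p)) ⟨
  + (2 ℕ.* (2 ℕ.* p)) ℤ.- 1ℤ ∎
  where
  open ≡-Reasoning
  p = 2 ℕ.^ n
  rearrange : ∀ x → + 3 ℤ.* (+ 2 ℤ.* x ℤ.- 1ℤ) ℤ.- + 2 ℤ.* (x ℤ.- 1ℤ)
                  ≡ + 2 ℤ.* (+ 2 ℤ.* x) ℤ.- 1ℤ
  rearrange = solve-∀

M≢0 : ∀ k .{{_ : ℕ.NonZero k}} → M k ≢ 0ℤ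
M≢0 (suc k) eq = ℕₚ.<⇒≢ (ℕₚ.*-monoʳ-≤ 2 (ℕₚ.m^n>0 2 k)) (sym 2^[1+k]≡1)
  where
  2^[1+k]≡1 : 2 ℕ.^ suc k ≡ 1
  2^[1+k]≡1 = ℤₚ.+-injective
    (ℤₚ.i-j≡0⇒i≡j (+ (2 ℕ.^ suc k)) 1ℤ (trans (sym (M-closed (suc k))) eq))

M-nonZero : ∀ k .{{_ : ℕ.NonZero k}} → ℚ.NonZero (fromℤ (M k))
M-nonZero k = ℚ.≢-nonZero {fromℤ (M k)} λ eq → M≢0 k (cong ℚ.↥_ eq)

-- HM k n is M_n^(k) = M_{kn} / M_k; the quotient is taken in ℚ, so that no
-- truncated division is involved.
HM : (k : ℕ) .{{_ : ℕ.NonZero k}} → ℕ → ℚ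
HM k n = (fromℤ (M (k ℕ.* n)) ÷ fromℤ (M k)) {{M-nonZero k}}

2^ : ℕ → ℚ
2^ k = fromℤ (+ (2 ℕ.^ k))

-- The tridiagonal Toeplitz block formed by rows and columns 2, …, n of V k n.
T : ℕ → ∀ n → Matrix ℚ n
T k (suc n) zero          zero          = 2^ k ℚ.+ 1ℚ
T k (suc n) zero          (suc zero)    = 1ℚ
T k (suc n) zero          (suc (suc j)) = 0ℚ
T k (suc n) (suc zero)    zero          = 2^ k
T k (suc n) (suc (suc i)) zero          = 0ℚ
T k (suc n) (suc i)       (suc j)       = T k n i j

V : (k : ℕ) .{{_ : ℕ.NonZero k}} → ∀ n → Matrix ℚ n
V k (suc n) zero          zero          = HM k 2
V k (suc n) zero          (suc zero)    = HM k 1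
V k (suc n) zero          (suc (suc j)) = 0ℚ
V k (suc n) (suc zero)    zero          = 2^ k
V k (suc n) (suc (suc i)) zero          = 0ℚ
V k (suc n) (suc i)       (suc j)       = T k n i j

-- In the expansion of a tridiagonal determinant along its top row, the second
-- minor is again block triangular. Hence det T and n ↦ M_{n+1}^(k) satisfy the
-- same recurrence x_{n+2} = (2^k+1) x_{n+1} - 2^k x_n with the same initial
-- values 1 and 2^k+1; the top row of V also agrees with this recurrence, because
-- M_1^(k) = 1 and M_2^(k) = 2^k+1.

module Submission where

open import Defs
open import Algebra.Bundles using (CommutativeRing)
open import Data.Fin.Base using (Fin; zero; suc; toℕ; punchIn)
open import Data.Integer.Base as ℤ using (+_; 1ℤ)
import Data.Integer.Properties as ℤₚ
import Data.Integer.Tactic.RingSolver as ℤ-RingSolver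
open import Data.Nat.Base as ℕ using (ℕ; zero; suc; _≥_; NonZero)
import Data.Nat.Properties as ℕₚ
open import Data.Rational.Base as ℚ using (ℚ; 0ℚ; 1ℚ; 1/_)
open import Data.Rational.Literals using (fromℤ)
import Data.Rational.Properties as ℚₚ
open import Data.Rational.Solver using (module +-*-Solver)
import Data.Rational.Unnormalised.Base as ℚᵘ
import Data.Rational.Unnormalised.Properties as ℚᵘₚ
open import Relation.Binary.PropositionalEquality using (_≡_; refl; sym; cong; cong₂; module ≡-Reasoning)

private variable
  n : ℕ

module DeterminantProperties {c ℓ} (R : CommutativeRing c ℓ) where
  open CommutativeRing R hiding (refl; sym; zero)
  open Determinant R using (minor) renaming (det to detᴿ)
  open import Algebra.Properties.Ring ring using (-1*x≈-x)
  open import Algebra.Properties.Semiring.Exp semiring using (_^_)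
  open import Algebra.Properties.Semiring.Sum semiring
    using (sum; sum-cong-≋; sum-replicate-zero)
  open import Relation.Binary.Reasoning.Setoid setoid

  sum-zero : (f : Fin n → Carrier) → (∀ j → f j ≈ 0#) → sum f ≈ 0#
  sum-zero {n} f f≈0 = trans (sum-cong-≋ f≈0) (sum-replicate-zero n)

  x*[0*y]≈0 : ∀ x {y} z → y ≈ 0# → x * (y * z) ≈ 0#
  x*[0*y]≈0 x {y} z y≈0 = begin
    x * (y * z)   ≈⟨ *-congˡ (*-congʳ y≈0) ⟩
    x * (0# * z)  ≈⟨ *-congˡ (zeroˡ z) ⟩
    x * 0#        ≈⟨ zeroʳ x ⟩
    0#            ∎

  x*[y*0]≈0 : ∀ x y {z} → z ≈ 0# → x * (y * z) ≈ 0#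
  x*[y*0]≈0 x y {z} z≈0 = begin
    x * (y * z)   ≈⟨ *-congˡ (*-congˡ z≈0) ⟩
    x * (y * 0#)  ≈⟨ *-congˡ (zeroʳ y) ⟩
    x * 0#        ≈⟨ zeroʳ x ⟩
    0#            ∎

  -- Induction along the top-row expansion: the term at column 0 has a zero entry as factor, and
  -- every other minor still has a zero first column.
  det-zeroColumn : (A : Matrix Carrier (suc n)) →
                   (∀ i → A i zero ≈ 0#) → detᴿ A ≈ 0#
  det-zeroColumn {n} A A₀≈0 = sum-zero {suc n} _ (term n A A₀≈0)
    where
    -- `n` is generalised because a nonzero column index forces it to be a successor, and only then
    -- does the minor have a first column.
    term : ∀ n (A : Matrix Carrier (suc n)) → (∀ i → A i zero ≈ 0#) → ∀ j →
           ((- 1#) ^ toℕ j) * (A zero j * detᴿ (minor A j)) ≈ 0#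
    term n       A A₀≈0 zero    = x*[0*y]≈0 _ _ (A₀≈0 zero)
    term (suc n) A A₀≈0 (suc j) =
      x*[y*0]≈0 _ _ (det-zeroColumn (minor A (suc j)) λ i → A₀≈0 (suc i))

  -- Deleting the top row and a column other than the first leaves a zero first column, so only the
  -- leading term survives.
  det-blockTriangular : (A : Matrix Carrier (suc n)) → (∀ i → A (suc i) zero ≈ 0#) →
                        detᴿ A ≈ A zero zero * detᴿ (minor A zero)
  det-blockTriangular {n} A A₀≈0 = begin
    detᴿ A                ≈⟨ +-congˡ (sum-zero {n} _ (term n A A₀≈0)) ⟩
    1# * a + 0#          ≈⟨ +-identityʳ _ ⟩
    1# * a               ≈⟨ *-identityˡ _ ⟩
    a                    ∎
    where
    a = A zero zero * detᴿ (minor A zero)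
    term : ∀ n (A : Matrix Carrier (suc n)) → (∀ i → A (suc i) zero ≈ 0#) → ∀ j →
           ((- 1#) ^ toℕ (suc j)) * (A zero (suc j) * detᴿ (minor A (suc j))) ≈ 0#
    term (suc n) A A₀≈0 j =
      x*[y*0]≈0 _ _ (det-zeroColumn (minor A (suc j)) A₀≈0)

  det-cong : {A B : Matrix Carrier n} → (∀ i j → A i j ≈ B i j) → detᴿ A ≈ detᴿ B
  det-cong {zero}  A≈B = CommutativeRing.refl R
  det-cong {suc n} A≈B = sum-cong-≋ λ j → *-congˡ {(- 1#) ^ toℕ j}
    (*-cong (A≈B zero j) (det-cong λ r s → A≈B (suc r) (punchIn j s)))

  -- The three-term recurrence of continuants. `B` and `C` are the trailing blocks of `A`, given up
  -- to entrywise equality, and only the first row and column of `A` need the tridiagonal shape;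
  -- this covers both `T` and `V`.
  det-continuant : (A : Matrix Carrier (suc (suc n)))
    (B : Matrix Carrier (suc n)) (C : Matrix Carrier n) →
    (∀ i j → A (suc i) (suc j) ≈ B i j) → (∀ i j → B (suc i) (suc j) ≈ C i j) →
    (∀ j → A zero (suc (suc j)) ≈ 0#) → (∀ i → A (suc (suc i)) zero ≈ 0#) →
    detᴿ A ≈ A zero zero * detᴿ B
           - A zero (suc zero) * (A (suc zero) zero * detᴿ C)
  det-continuant {n} A B C A≈B B≈C row≈0 col≈0 = begin
    detᴿ A
      ≈⟨ +-congˡ (+-congˡ (sum-zero {n} _ λ j → x*[0*y]≈0 _ _ (row≈0 j))) ⟩
    1# * (a * detᴿ (minor A zero)) + ((- 1#) ^ 1 * (b * detᴿ A₁) + 0#)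
      ≈⟨ +-cong (*-identityˡ _) (+-identityʳ _) ⟩
    a * detᴿ (minor A zero) + (- 1#) ^ 1 * (b * detᴿ A₁)
      -- The first column of `A₁` is `d` followed by zeros, so `A₁` is block triangular.
      ≈⟨ +-cong (*-congˡ (det-cong A≈B))
                (*-cong (*-identityʳ (- 1#)) (*-congˡ (det-blockTriangular A₁ col≈0))) ⟩
    a * detᴿ B + - 1# * (b * (d * detᴿ (minor A₁ zero)))
      ≈⟨ +-congˡ (-1*x≈-x _) ⟩
    a * detᴿ B - b * (d * detᴿ (minor A₁ zero))
      ≈⟨ +-congˡ (-‿cong (*-congˡ (*-congˡ (det-cong λ i j →
           trans (A≈B (suc i) (suc j)) (B≈C i j))))) ⟩
    a * detᴿ B - b * (d * detᴿ C) ∎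
    where
    a = A zero zero
    b = A zero (suc zero)
    d = A (suc zero) zero
    A₁ = minor A (suc zero)

open DeterminantProperties ℚₚ.+-*-commutativeRing using (det-continuant)

-- Addition in `ℚ` normalises its result, so the comparison is made in `ℚᵘ`, where the sum is
-- `i * 1 + j * 1` over 1.
fromℤ-homo-+ : ∀ i j → fromℤ (i ℤ.+ j) ≡ fromℤ i ℚ.+ fromℤ j
fromℤ-homo-+ i j = ℚₚ.toℚᵘ-injective (ℚᵘₚ.≃-trans
  (ℚᵘ.*≡* (cong (ℤ._* 1ℤ) (cong₂ ℤ._+_ (sym (ℤₚ.*-identityʳ i)) (sym (ℤₚ.*-identityʳ j)))))
  (ℚᵘₚ.≃-sym (ℚₚ.toℚᵘ-homo-+ (fromℤ i) (fromℤ j))))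

fromℤ-homo-* : ∀ i j → fromℤ (i ℤ.* j) ≡ fromℤ i ℚ.* fromℤ j
fromℤ-homo-* i j = ℚₚ.toℚᵘ-injective (ℚᵘₚ.≃-trans
  (ℚᵘ.*≡* refl)
  (ℚᵘₚ.≃-sym (ℚₚ.toℚᵘ-homo-* (fromℤ i) (fromℤ j))))

2^[k*[1+n]] : ∀ k n → + (2 ℕ.^ (k ℕ.* suc n)) ≡ + (2 ℕ.^ k) ℤ.* + (2 ℕ.^ (k ℕ.* n))
2^[k*[1+n]] k n = begin
  + (2 ℕ.^ (k ℕ.* suc n))               ≡⟨ cong (λ m → + (2 ℕ.^ m)) (ℕₚ.*-suc k n) ⟩
  + (2 ℕ.^ (k ℕ.+ k ℕ.* n))             ≡⟨ cong +_ (ℕₚ.^-distribˡ-+-* 2 k (k ℕ.* n)) ⟩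
  + (2 ℕ.^ k ℕ.* 2 ℕ.^ (k ℕ.* n))       ≡⟨ ℤₚ.pos-* (2 ℕ.^ k) (2 ℕ.^ (k ℕ.* n)) ⟩
  + (2 ℕ.^ k) ℤ.* + (2 ℕ.^ (k ℕ.* n))   ∎
  where open ≡-Reasoning

-- The subtracted term is moved to the left, so that the transfer to ℚ only
-- needs fromℤ to preserve + and *.
M-recurrence : ∀ k n →
  M (k ℕ.* suc (suc n)) ℤ.+ + (2 ℕ.^ k) ℤ.* M (k ℕ.* n) ≡
  (+ (2 ℕ.^ k) ℤ.+ 1ℤ) ℤ.* M (k ℕ.* suc n)
M-recurrence k n = begin
  M (k ℕ.* suc (suc n)) ℤ.+ q ℤ.* M (k ℕ.* n)
    ≡⟨ cong₂ (λ x y → x ℤ.+ q ℤ.* y) (M-closed (k ℕ.* suc (suc n))) (M-closed (k ℕ.* n)) ⟩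
  + (2 ℕ.^ (k ℕ.* suc (suc n))) ℤ.- 1ℤ ℤ.+ q ℤ.* (r ℤ.- 1ℤ)
    ≡⟨ cong (λ x → x ℤ.- 1ℤ ℤ.+ q ℤ.* (r ℤ.- 1ℤ)) (2^[k*[1+n]] k (suc n)) ⟩
  q ℤ.* s ℤ.- 1ℤ ℤ.+ q ℤ.* (r ℤ.- 1ℤ)
    ≡⟨ cong (λ x → q ℤ.* x ℤ.- 1ℤ ℤ.+ q ℤ.* (r ℤ.- 1ℤ)) (2^[k*[1+n]] k n) ⟩
  q ℤ.* (q ℤ.* r) ℤ.- 1ℤ ℤ.+ q ℤ.* (r ℤ.- 1ℤ)
    -- This holds because `q` and 1 are the roots of `x^2 - (q + 1) x + q`, and `M (k * n)` is
    -- `q^n - 1`.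
    ≡⟨ rearrange q r ⟩
  (q ℤ.+ 1ℤ) ℤ.* (q ℤ.* r ℤ.- 1ℤ)
    ≡⟨ cong (λ x → (q ℤ.+ 1ℤ) ℤ.* (x ℤ.- 1ℤ)) (2^[k*[1+n]] k n) ⟨
  (q ℤ.+ 1ℤ) ℤ.* (s ℤ.- 1ℤ)
    ≡⟨ cong ((q ℤ.+ 1ℤ) ℤ.*_) (M-closed (k ℕ.* suc n)) ⟨
  (q ℤ.+ 1ℤ) ℤ.* M (k ℕ.* suc n) ∎
  where
  open ≡-Reasoning
  q = + (2 ℕ.^ k)
  r = + (2 ℕ.^ (k ℕ.* n))
  s = + (2 ℕ.^ (k ℕ.* suc n))
  rearrange : ∀ q r → q ℤ.* (q ℤ.* r) ℤ.- 1ℤ ℤ.+ q ℤ.* (r ℤ.- 1ℤ) ≡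
                      (q ℤ.+ 1ℤ) ℤ.* (q ℤ.* r ℤ.- 1ℤ)
  rearrange = ℤ-RingSolver.solve-∀

fromℤ-M-recurrence : ∀ k n →
  fromℤ (M (k ℕ.* suc (suc n))) ℚ.+ 2^ k ℚ.* fromℤ (M (k ℕ.* n)) ≡
  (2^ k ℚ.+ 1ℚ) ℚ.* fromℤ (M (k ℕ.* suc n))
fromℤ-M-recurrence k n = begin
  fromℤ x ℚ.+ 2^ k ℚ.* fromℤ z      ≡⟨ cong (fromℤ x ℚ.+_) (fromℤ-homo-* q z) ⟨
  fromℤ x ℚ.+ fromℤ (q ℤ.* z)       ≡⟨ fromℤ-homo-+ x (q ℤ.* z) ⟨
  fromℤ (x ℤ.+ q ℤ.* z)             ≡⟨ cong fromℤ (M-recurrence k n) ⟩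
  fromℤ ((q ℤ.+ 1ℤ) ℤ.* y)          ≡⟨ fromℤ-homo-* (q ℤ.+ 1ℤ) y ⟩
  fromℤ (q ℤ.+ 1ℤ) ℚ.* fromℤ y      ≡⟨ cong (ℚ._* fromℤ y) (fromℤ-homo-+ q 1ℤ) ⟩
  (2^ k ℚ.+ fromℤ 1ℤ) ℚ.* fromℤ y   ≡⟨⟩
  (2^ k ℚ.+ 1ℚ) ℚ.* fromℤ y         ∎
  where
  open ≡-Reasoning
  q = + (2 ℕ.^ k)
  x = M (k ℕ.* suc (suc n))
  y = M (k ℕ.* suc n)
  z = M (k ℕ.* n)

det-singleton : (A : Matrix ℚ 1) → det A ≡ A zero zero
det-singleton A = solve 1 (λ a → con 1ℚ :* (a :* con 1ℚ) :+ con 0ℚ := a) refl (A zero zero)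
  where open +-*-Solver

module _ (k : ℕ) .{{_ : NonZero k}} where
  open ≡-Reasoning

  HM-zero : HM k 0 ≡ 0ℚ
  HM-zero = begin
    HM k 0                    ≡⟨ cong (λ m → fromℤ (M m) ℚ.* 1/M) (ℕₚ.*-zeroʳ k) ⟩
    0ℚ ℚ.* 1/M                ≡⟨ ℚₚ.*-zeroˡ 1/M ⟩
    0ℚ                        ∎
    where 1/M = (1/ fromℤ (M k)) {{M-nonZero k}}

  HM-one : HM k 1 ≡ 1ℚ
  HM-one = begin
    HM k 1                    ≡⟨ cong (λ m → fromℤ (M m) ℚ.* 1/M) (ℕₚ.*-identityʳ k) ⟩
    fromℤ (M k) ℚ.* 1/M       ≡⟨ ℚₚ.*-inverseʳ (fromℤ (M k)) {{M-nonZero k}} ⟩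
    1ℚ                        ∎
    where 1/M = (1/ fromℤ (M k)) {{M-nonZero k}}

  HM-recurrence : ∀ n → HM k (suc (suc n)) ≡
    (2^ k ℚ.+ 1ℚ) ℚ.* HM k (suc n) ℚ.- 2^ k ℚ.* HM k n
  HM-recurrence n = begin
    x ℚ.* i
      -- Division by `M k` is multiplication by `i`, an atom for the solver. Adding and subtracting
      -- `q * z` creates the left side of `fromℤ-M-recurrence`.
      ≡⟨ solve 4 (λ x q z i → x :* i := (x :+ q :* z) :* i :- q :* (z :* i)) refl x (2^ k) z i ⟩
    (x ℚ.+ 2^ k ℚ.* z) ℚ.* i ℚ.- 2^ k ℚ.* (z ℚ.* i)
      ≡⟨ cong (λ w → w ℚ.* i ℚ.- 2^ k ℚ.* (z ℚ.* i)) (fromℤ-M-recurrence k n) ⟩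
    (2^ k ℚ.+ 1ℚ) ℚ.* y ℚ.* i ℚ.- 2^ k ℚ.* (z ℚ.* i)
      ≡⟨ cong (ℚ._- 2^ k ℚ.* (z ℚ.* i)) (ℚₚ.*-assoc (2^ k ℚ.+ 1ℚ) y i) ⟩
    (2^ k ℚ.+ 1ℚ) ℚ.* (y ℚ.* i) ℚ.- 2^ k ℚ.* (z ℚ.* i) ∎
    where
    open +-*-Solver
    x = fromℤ (M (k ℕ.* suc (suc n)))
    y = fromℤ (M (k ℕ.* suc n))
    z = fromℤ (M (k ℕ.* n))
    i = (1/ fromℤ (M k)) {{M-nonZero k}}

  -- In essence the factorisation of `2^(2k) - 1` as a difference of squares, read off here from the
  -- recurrence with initial values 0 and 1.
  HM-two : HM k 2 ≡ 2^ k ℚ.+ 1ℚ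
  HM-two = begin
    HM k 2
      ≡⟨ HM-recurrence 0 ⟩
    (2^ k ℚ.+ 1ℚ) ℚ.* HM k 1 ℚ.- 2^ k ℚ.* HM k 0
      ≡⟨ cong₂ (λ x y → (2^ k ℚ.+ 1ℚ) ℚ.* x ℚ.- 2^ k ℚ.* y) HM-one HM-zero ⟩
    (2^ k ℚ.+ 1ℚ) ℚ.* 1ℚ ℚ.- 2^ k ℚ.* 0ℚ
      ≡⟨ solve 1 (λ q → (q :+ con 1ℚ) :* con 1ℚ :- q :* con 0ℚ := q :+ con 1ℚ) refl (2^ k) ⟩
    2^ k ℚ.+ 1ℚ ∎
    where open +-*-Solver

  -- Not definitional: the clauses of T and V first split on the row index.
  T-suc : ∀ n i j → T k (suc n) (suc i) (suc j) ≡ T k n i j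
  T-suc n zero    j = refl
  T-suc n (suc i) j = refl

  V-suc : ∀ n i j → V k (suc n) (suc i) (suc j) ≡ T k n i j
  V-suc n zero    j = refl
  V-suc n (suc i) j = refl

  -- The factor `1ℚ` is the entry above the diagonal. It is kept so that the expansion of `V`, once
  -- its top row is evaluated, has the same right-hand side.
  det-T-recurrence : ∀ n → det (T k (suc (suc n))) ≡
    (2^ k ℚ.+ 1ℚ) ℚ.* det (T k (suc n)) ℚ.- 1ℚ ℚ.* (2^ k ℚ.* det (T k n))
  det-T-recurrence n = det-continuant (T k (suc (suc n))) (T k (suc n)) (T k n)
    (T-suc (suc n)) (T-suc n) (λ _ → refl) (λ _ → refl)

  HM≡det-T : ∀ n → HM k (suc n) ≡ det (T k n)
  -- The empty determinant is 1, so size `n` is paired with index `suc n`.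
  HM≡det-T zero          = HM-one
  HM≡det-T (suc zero)    = begin
    HM k 2                    ≡⟨ HM-two ⟩
    2^ k ℚ.+ 1ℚ               ≡⟨ det-singleton (T k 1) ⟨
    det (T k 1)               ∎
  HM≡det-T (suc (suc n)) = begin
    HM k (suc (suc (suc n)))
      ≡⟨ HM-recurrence (suc n) ⟩
    (2^ k ℚ.+ 1ℚ) ℚ.* HM k (suc (suc n)) ℚ.- 2^ k ℚ.* HM k (suc n)
      ≡⟨ cong₂ (λ x y → (2^ k ℚ.+ 1ℚ) ℚ.* x ℚ.- 2^ k ℚ.* y) (HM≡det-T (suc n)) (HM≡det-T n) ⟩
    (2^ k ℚ.+ 1ℚ) ℚ.* det (T k (suc n)) ℚ.- 2^ k ℚ.* det (T k n)
      ≡⟨ cong (λ x → (2^ k ℚ.+ 1ℚ) ℚ.* det (T k (suc n)) ℚ.- x) (ℚₚ.*-identityˡ (2^ k ℚ.* det (T k n))) ⟨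
    (2^ k ℚ.+ 1ℚ) ℚ.* det (T k (suc n)) ℚ.- 1ℚ ℚ.* (2^ k ℚ.* det (T k n))
      ≡⟨ det-T-recurrence n ⟨
    det (T k (suc (suc n))) ∎

  -- The trailing blocks of `V` are already those of `T`, so a single expansion suffices; the top
  -- rows then agree by `HM-two` and `HM-one`.
  det-V≡det-T : ∀ n → det (V k n) ≡ det (T k n)
  det-V≡det-T zero          = refl
  det-V≡det-T (suc zero)    = begin
    det (V k 1)               ≡⟨ det-singleton (V k 1) ⟩
    HM k 2                    ≡⟨ HM-two ⟩
    2^ k ℚ.+ 1ℚ               ≡⟨ det-singleton (T k 1) ⟨
    det (T k 1)               ∎
  det-V≡det-T (suc (suc n)) = begin
    det (V k (suc (suc n)))
      ≡⟨ det-continuant (V k (suc (suc n))) (T k (suc n)) (T k n)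
           (V-suc (suc n)) (T-suc n) (λ _ → refl) (λ _ → refl) ⟩
    HM k 2 ℚ.* det (T k (suc n)) ℚ.- HM k 1 ℚ.* (2^ k ℚ.* det (T k n))
      ≡⟨ cong₂ (λ x y → x ℚ.* det (T k (suc n)) ℚ.- y ℚ.* (2^ k ℚ.* det (T k n))) HM-two HM-one ⟩
    (2^ k ℚ.+ 1ℚ) ℚ.* det (T k (suc n)) ℚ.- 1ℚ ℚ.* (2^ k ℚ.* det (T k n))
      ≡⟨ det-T-recurrence n ⟨
    det (T k (suc (suc n))) ∎

theorem3p3 : (k : ℕ) .{{_ : NonZero k}} (n : ℕ) → n ≥ 1 → HM k (suc n) ≡ det (V k n)
theorem3p3 k n _ = begin
  HM k (suc n)   ≡⟨ HM≡det-T k n ⟩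
  det (T k n)    ≡⟨ det-V≡det-T k n ⟨
  det (V k n)    ∎
  where open ≡-Reasoning
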